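{- Let $a\in\mathbb{N}$ (with $0\in\mathbb{N}$). Then, in any summable set $\mathcal{U}$ such that $\mathbf{S}(\mathcal{U})$ contains the function $x\mapsto x^a$, it follows that $$\mathrm{ess}(x\mapsto x^a)=B_a,$$ where $\mathrm{ess}$ is the essence relative to $\mathcal{U}$ and $B_a$ are the Bernoulli numbers with the convention $B_1=\tfrac12$.
   Context: Sets of functions. $\mathbb{C}^{\mathbb{C}}$ is the set of all functions $\mathbb{C}\to\mathbb{C}$; $x\mapsto x^0$ is the constant function $1$. For $X\subset\mathbb{C}^{\mathbb{C}}$: $\mathbf{L}(X)$ is the set of all (finite, complex) linear combinations of functions in $X$; $\mathbf{T}(X)$ is the set of all translates $x\mapsto g(x+c)$ with $g\in X$, $c\in\mathbb{C}$; and $\mathbf{S}(X):=\mathbf{L}(\mathbf{T}(X))$. Polynomial sums. For a complex polynomial $p$, let $P$ be the unique polynomial with $P(z)-P(z-1)=p(z)$ for all $z$ and $P(0)=0$; the fractional sum of $p$ from $x$ to $y$ is $P(y)-P(x-1)$, for $x,y\in\mathbb{C}$. Fractional summable functions. $f:\mathbb{C}\to\mathbb{C}$ is fractional summable if there are a degree bound $m$ and a sequence $(p_n)_{n\in\mathbb{N}}$ of polynomials of degree $\le m$ (the null polynomial has degree $-\infty$) such that $|f(n+x)-p_n(n+x)|\to 0$ as $n\to\infty$ for all $x\in\mathbb{C}$, and such that for all $x,y\in\mathbb{C}$ the limit as $n\to\infty$ of (fractional sum of $p_n$ from $n+x$ to $n+y$) $+\sum_{\nu=1}^n\bigl(f(\nu+x-1)-f(\nu+y)\bigr)$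 exists. $\mathcal{F}$ is the set of functions $\mathbb{C}\to\mathbb{C}$ that are linear combinations of holomorphic (entire) functions and fractional summable functions. Summable sets. A set $\mathcal{U}\subset\mathcal{F}$ is a summable set if there is a unique map $\Sigma_{\mathcal{U}}:\mathbf{S}(\mathcal{U})\times\mathbb{C}^2\to\mathbb{C}$, $(f,x,y)\mapsto\Sigma_{\mathcal{U}}(f;x,y)$ (thought of as "$\sum_{k=x}^y f(k)$"), satisfying, for all $f,g\in\mathbf{S}(\mathcal{U})$ and $x,y,z,s,\lambda,\mu\in\mathbb{C}$: (A1) $\Sigma_{\mathcal{U}}(f;x,y)+\Sigma_{\mathcal{U}}(f;y+1,z)=\Sigma_{\mathcal{U}}(f;x,z)$; (A2) $\Sigma_{\mathcal{U}}(f;x+s,y+s)=\Sigma_{\mathcal{U}}(h;x,y)$ where $h(t)=f(t+s)$; (A3) $\Sigma_{\mathcal{U}}(\lambda f+\mu g;x,y)=\lambda\Sigma_{\mathcal{U}}(f;x,y)+\mu\Sigma_{\mathcal{U}}(g;x,y)$; (A4) $\Sigma_{\mathcal{U}}(f;1,1)=f(1)$; (A5*) if $f$ is holomorphic, then $x\mapsto\Sigma_{\mathcal{U}}(f;1,x)$ is holomorphic on $\mathbb{C}$; (A6) if $\lim_{n\to\infty}f(t+n)=0$ for every $t\in\mathbb{C}$, then $\lim_{n\to\infty}\Sigma_{\mathcal{U}}(f(\cdot+n);x,y)=0$; moreover, if there is a sequence $(p_n)$ of polynomials of fixed degree (independent of $n$) with $|f(t+n)-p_n(t+n)|\to0$ for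 all $t\in\mathbb{C}$, then $\Sigma_{\mathcal{U}}(f(\cdot+n);x,y)$ minus the fractional sum of the polynomial $p_n(\cdot+n)$ from $x$ to $y$ tends to $0$ as $n\to\infty$. The map $\Sigma_{\mathcal{U}}$ is called the fractional sum relative to $\mathcal{U}$. Essence. For $f\in\mathbf{S}(\mathcal{U})$, the essence of $f$ relative to $\mathcal{U}$ is $\mathrm{ess}(f):=\lim_{h\to0}\frac1h\Sigma_{\mathcal{U}}(f;1,h)$ ($h\in\mathbb{C}\setminus\{0\}$), if the limit exists; then $f$ is said to be a function with essence in $\mathcal{U}$. -}

module Defs where

open import Algebra.Bundles.Raw using (RawRing)
open import Algebra.Structures using (IsCommutativeRing)
import Algebra.Definitions.RawSemiring as RawSemiringDefinitions
open import Data.Fin.Base using (Fin; toℕ; fromℕ)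
open import Data.Nat.Base as ℕ using (ℕ; zero; suc)
open import Data.Nat.Combinatorics using (_C_)
open import Data.Product.Base using (Σ-syntax; ∃; ∃-syntax; _×_)
open import Data.Sum.Base using (_⊎_)
open import Data.Vec.Base using (Vec; []; _∷ʳ_; lookup)
open import Data.Vec.Functional using (Vector)
open import Level using (0ℓ)
open import Relation.Binary.Core using (Rel)
open import Relation.Binary.PropositionalEquality using (_≡_; _≢_; _≗_)
open import Relation.Binary.Structures using (IsStrictTotalOrder)
open import Relation.Nullary using (¬_)
open import Relation.Unary using (Pred; _∈_; _⊆_; _∪_; Satisfiable)

-- The classical axioms for the real numbers, which determine them up to
-- isomorphism.  The value of 0# ⁻¹ is left unspecified.
record CompleteOrderedField : Set₁ where
  infix  4 _<_
  infixl 6 _+_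
  infixl 7 _*_
  infix  8 -_
  infix  9 _⁻¹
  field
    Carrier : Set
    _<_     : Rel Carrier 0ℓ
    _+_ _*_ : Carrier → Carrier → Carrier
    -_ _⁻¹  : Carrier → Carrier
    0# 1#   : Carrier

    isCommutativeRing  : IsCommutativeRing _≡_ _+_ _*_ -_ 0# 1#
    0≢1                : 0# ≢ 1#
    ⁻¹-inverseʳ        : ∀ {x} → x ≢ 0# → x * x ⁻¹ ≡ 1#

    isStrictTotalOrder : IsStrictTotalOrder _≡_ _<_
    +-monoˡ-<          : ∀ {x y} z → x < y → x + z < y + z
    *-pos              : ∀ {x y} → 0# < x → 0# < y → 0# < x * y

  UpperBound : Pred Carrier 0ℓ → Pred Carrier 0ℓ
  UpperBound P u = ∀ {x} → x ∈ P → ¬ (u < x)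

  field
    supremum : ∀ (P : Pred Carrier 0ℓ) → Satisfiable P → ∃ (UpperBound P) →
               ∃[ s ] UpperBound P s × (∀ u → UpperBound P u → ¬ (u < s))

module FractionalSums (ℝ : CompleteOrderedField) where

  private module ℝ = CompleteOrderedField ℝ

  record ℂ : Set where
    constructor _+i_
    field
      re im : ℝ.Carrier
  open ℂ public

  ℂ-rawRing : RawRing 0ℓ 0ℓ
  ℂ-rawRing = record
    { Carrier = ℂ
    ; _≈_     = _≡_
    ; _+_     = λ z w → (re z ℝ.+ re w) +i (im z ℝ.+ im w)
    ; _*_     = λ z w → (re z ℝ.* re w ℝ.+ ℝ.- (im z ℝ.* im w))
                     +i (re z ℝ.* im w ℝ.+ im z ℝ.* re w)
    ; -_      = λ z → (ℝ.- re z) +i (ℝ.- im z)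
    ; 0#      = ℝ.0# +i ℝ.0#
    ; 1#      = ℝ.1# +i ℝ.0#
    }

  open RawRing ℂ-rawRing public using (_+_; _*_; -_; 0#; 1#)
  open RawSemiringDefinitions (RawRing.rawSemiring ℂ-rawRing) public
    using (sum; _^_) renaming (_×_ to _·_)

  infixl 6 _-_
  infixl 7 _/_

  _-_ : ℂ → ℂ → ℂ
  z - w = z + - w

  normSq : ℂ → ℝ.Carrier
  normSq z = re z ℝ.* re z ℝ.+ im z ℝ.* im z

  -- Meaningful for w ≢ 0# only.
  _/_ : ℂ → ℂ → ℂ
  z / w = z * ((re w ℝ.* normSq w ℝ.⁻¹) +i (ℝ.- im w ℝ.* normSq w ℝ.⁻¹))

  ι : ℕ → ℂ
  ι n = n · 1#

  -- For ε > 0 this says that √(re z ² + im z ²) < ε.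
  ∣_∣<_ : ℂ → ℝ.Carrier → Set
  ∣ z ∣< ε = normSq z ℝ.< ε ℝ.* ε

  _⟶_ : (ℕ → ℂ) → ℂ → Set
  s ⟶ l = ∀ ε → ℝ.0# ℝ.< ε →
    ∃[ N ] ∀ n → N ℕ.≤ n → ∣ s n - l ∣< ε

  -- g h ⟶ l as h ⟶ 0 through nonzero complex numbers.
  _⟶₀_ : (ℂ → ℂ) → ℂ → Set
  g ⟶₀ l = ∀ ε → ℝ.0# ℝ.< ε →
    ∃[ δ ] (ℝ.0# ℝ.< δ) × (∀ h → h ≢ 0# → ∣ h ∣< δ → ∣ g h - l ∣< ε)

  Fun : Set
  Fun = ℂ → ℂ

  Holomorphic : Pred Fun 0ℓ
  Holomorphic f = ∀ z → ∃[ l ] (λ h → (f (z + h) - f z) / h) ⟶₀ l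

  shift : Fun → ℂ → Fun
  shift f s t = f (t + s)

  -- Subsets of ℂ^ℂ are predicates on Fun; functions are compared pointwise.

  𝐋 : ∀ {ℓ} → Pred Fun ℓ → Pred Fun ℓ
  𝐋 X f = ∃[ n ] Σ[ c ∈ Vector ℂ n ] Σ[ g ∈ Vector Fun n ]
    (∀ i → g i ∈ X) × (f ≗ λ x → sum (λ i → c i * g i x))

  𝐓 : ∀ {ℓ} → Pred Fun ℓ → Pred Fun ℓ
  𝐓 X f = ∃[ g ] ∃[ c ] (g ∈ X) × (f ≗ shift g c)

  𝐒 : ∀ {ℓ} → Pred Fun ℓ → Pred Fun ℓ
  𝐒 X = 𝐋 (𝐓 X)

  -- Coefficients of 1, x, …, x ^ d.  They may vanish, so Poly d consists of
  -- the polynomials of degree at most d, including the null polynomial.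
  Poly : ℕ → Set
  Poly d = Vector ℂ (suc d)

  eval : ∀ {d} → Poly d → Fun
  eval p z = sum (λ i → p i * z ^ toℕ i)

  -- All terms have degree exactly d, or all are the null polynomial.
  FixedDegree : ∀ {d} → (ℕ → Poly d) → Set
  FixedDegree {d} p = (∀ n → p n (fromℕ d) ≢ 0#) ⊎ (∀ n i → p n i ≡ 0#)

  -- σ is the fractional sum from x to y of the polynomial function p.  The
  -- polynomial P is unique, so at most one σ qualifies.
  IsPolynomialSum : Fun → ℂ → ℂ → ℂ → Set
  IsPolynomialSum p x y σ = ∃[ e ] Σ[ P ∈ Poly e ]
      (∀ z → eval P z - eval P (z - 1#) ≡ p z)
    × eval P 0# ≡ 0#
    × σ ≡ eval P y - eval P (x - 1#)

  -- The index i stands for ν - 1.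
  FractionalSummable : Pred Fun 0ℓ
  FractionalSummable f = ∃[ m ] Σ[ p ∈ (ℕ → Poly m) ]
      (∀ x → (λ n → f (ι n + x) - eval (p n) (ι n + x)) ⟶ 0#)
    × (∀ x y → Σ[ σ ∈ (ℕ → ℂ) ]
          (∀ n → IsPolynomialSum (eval (p n)) (ι n + x) (ι n + y) (σ n))
        × (∃[ l ] (λ n → σ n + sum {n} (λ i →
                     f (ι (suc (toℕ i)) + x - 1#) - f (ι (suc (toℕ i)) + y)))
                  ⟶ l))

  𝓕 : Pred Fun 0ℓ
  𝓕 = 𝐋 (Holomorphic ∪ FractionalSummable)

  -- A map 𝐒(U) × ℂ² → ℂ.  By ⟦⟧-cong its value does not depend on the
  -- membership proof, so in the axioms below membership proofs of derived
  -- functions can be quantified universally.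
  record SumMap {ℓ} (U : Pred Fun ℓ) : Set ℓ where
    field
      ⟦_⟧    : ∀ {f} → f ∈ 𝐒 U → ℂ → ℂ → ℂ
      ⟦⟧-cong : ∀ {f g} (p : f ∈ 𝐒 U) (q : g ∈ 𝐒 U) → f ≗ g →
                ∀ x y → ⟦ p ⟧ x y ≡ ⟦ q ⟧ x y

  record SumAxioms {ℓ} (U : Pred Fun ℓ) (S : SumMap U) : Set ℓ where
    open SumMap S
    field
      continuedSummation : ∀ {f} (p : f ∈ 𝐒 U) x y z →
        ⟦ p ⟧ x y + ⟦ p ⟧ (y + 1#) z ≡ ⟦ p ⟧ x z

      translationInvariance : ∀ {f} (p : f ∈ 𝐒 U) s (q : shift f s ∈ 𝐒 U) x y →
        ⟦ p ⟧ (x + s) (y + s) ≡ ⟦ q ⟧ x y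

      linearity : ∀ {f g} (p : f ∈ 𝐒 U) (q : g ∈ 𝐒 U) a b
        (r : (λ t → a * f t + b * g t) ∈ 𝐒 U) x y →
        ⟦ r ⟧ x y ≡ a * ⟦ p ⟧ x y + b * ⟦ q ⟧ x y

      classicalConsistency : ∀ {f} (p : f ∈ 𝐒 U) → ⟦ p ⟧ 1# 1# ≡ f 1#

      holomorphicSums : ∀ {f} (p : f ∈ 𝐒 U) →
        Holomorphic f → Holomorphic (⟦ p ⟧ 1#)

      rightShiftContinuity : ∀ {f} → f ∈ 𝐒 U →
        (∀ t → (λ n → f (t + ι n)) ⟶ 0#) →
        ∀ (q : ∀ n → shift f (ι n) ∈ 𝐒 U) x y →
        (λ n → ⟦ q n ⟧ x y) ⟶ 0#

      polynomialShiftContinuity : ∀ {f} → f ∈ 𝐒 U →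
        ∀ {d} (p : ℕ → Poly d) → FixedDegree p →
        (∀ t → (λ n → f (t + ι n) - eval (p n) (t + ι n)) ⟶ 0#) →
        ∀ (q : ∀ n → shift f (ι n) ∈ 𝐒 U) x y (σ : ℕ → ℂ) →
        (∀ n → IsPolynomialSum (shift (eval (p n)) (ι n)) x y (σ n)) →
        (λ n → ⟦ q n ⟧ x y - σ n) ⟶ 0#

  record SummableSet {ℓ} (U : Pred Fun ℓ) : Set ℓ where
    field
      ⊆𝓕     : U ⊆ 𝓕
      sumMap  : SumMap U
      axioms  : SumAxioms U sumMap
      unique  : ∀ (S : SumMap U) → SumAxioms U S →
                ∀ {f} (p : f ∈ 𝐒 U) x y →
                SumMap.⟦_⟧ S p x y ≡ SumMap.⟦_⟧ sumMap p x y

  -- The defining limit of ess(f) exists and equals b.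
  HasEssence : ∀ {ℓ} {U : Pred Fun ℓ} → SummableSet U →
               ∀ {f} → f ∈ 𝐒 U → ℂ → Set
  HasEssence 𝓤 p b = (λ h → (1# / h) * ⟦ p ⟧ 1# h) ⟶₀ b
    where open SumMap (SummableSet.sumMap 𝓤)

  -- The recurrence ∑_{k ≤ n} (n+1 C k) B_k = n + 1, solved for B_n; the right
  -- side n + 1 (rather than 0 for n > 0) gives the convention B_1 = 1/2.
  nextBernoulli : ∀ n → Vec ℂ n → ℂ
  nextBernoulli n bs =
    (ι (suc n) - sum (λ (k : Fin n) → ι (suc n C toℕ k) * lookup bs k))
      / ι (suc n)

  -- B_0, …, B_{n-1}
  bernoullis : ∀ n → Vec ℂ n
  bernoullis zero    = []
  bernoullis (suc n) = bernoullis n ∷ʳ nextBernoulli n (bernoullis n)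

  bernoulli : ℕ → ℂ
  bernoulli n = nextBernoulli n (bernoullis n)

{-# OPTIONS --safe #-}
module Submission where

-- Let P be the polynomial with P(z) − P(z − 1) = zᵃ and P(0) = 0.  By continued
-- summation, ∑ₓʸ kᵃ − (P(y) − P(x − 1)) is unchanged when x and y both increase
-- by 1, and by right shift continuity it tends to 0 along x + n, y + n; hence
-- it is 0 and ∑₁ʰ kᵃ = P(h), so the essence is the linear coefficient of P.
-- Applying the binomial theorem to (z + 1)ᵃ⁺¹ − zᵃ⁺¹ expresses P through the
-- polynomials of the lower powers, and on linear coefficients this relation is
-- the recurrence of the Bernoulli numbers.

open import Defs
open import Algebra.Bundles using (CommutativeRing)
import Algebra.Properties.AbelianGroup as AbelianGroupProperties
import Algebra.Properties.CommutativeSemigroup as CommutativeSemigroupProperties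
import Algebra.Properties.CommutativeSemiring.Binomial as Binomial
import Algebra.Properties.Ring as RingProperties
import Algebra.Properties.Semiring.Mult as Multiples
import Algebra.Properties.Semiring.Mult.TCOptimised as OptimisedMultiples
import Algebra.Properties.Semiring.Sum as SumProperties
import Algebra.Solver.Ring as RingSolver
import Algebra.Solver.Ring.AlmostCommutativeRing as ACR
open import Algebra.Structures using (IsCommutativeRing)
open import Data.Fin.Base using (Fin; zero; suc; toℕ; fromℕ; inject₁)
open import Data.Fin.Properties using (toℕ<n; toℕ-fromℕ; toℕ-inject₁)
open import Data.Fin.Relation.Unary.Top using (view; ‵fromℕ; ‵inject₁)
open import Data.Integer.Base as ℤ using (ℤ; +_; -[1+_]; _⊖_)
import Data.Integer.Properties as ℤ
open import Data.Maybe.Base as Maybe using (Maybe)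
open import Data.Nat.Base as ℕ using (ℕ; zero; suc)
open import Data.Nat.Combinatorics using (_C_; nCk≡nC[n∸k]; nC1≡n; nCn≡1)
open import Data.Nat.Induction using (<-rec)
import Data.Nat.Properties as ℕ
open import Data.Product.Base using (Σ-syntax; ∃-syntax; _×_; _,_; uncurry)
open import Data.Sum.Base using (inj₁; inj₂)
open import Data.Vec.Base as Vec using (Vec; lookup; _∷ʳ_)
open import Data.Vec.Functional using (_∷_)
open import Function.Base using (_∘_)
open import Level using (0ℓ)
open import Relation.Binary.Bundles using (StrictTotalOrder)
import Relation.Binary.Construct.StrictToNonStrict as StrictToNonStrict
open import Relation.Binary.Definitions using (DecidableEquality; tri<; tri≈; tri>)
open import Relation.Binary.PropositionalEquality
  using (_≡_; _≢_; _≗_; refl; sym; trans; cong; cong₂; subst; subst₂; isEquivalence; module ≡-Reasoning)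
import Relation.Binary.Reasoning.Setoid as SetoidReasoning
import Relation.Binary.Reasoning.StrictPartialOrder as StrictReasoning
open import Relation.Nullary using (contradiction; yes; no; _×-dec_)
open import Relation.Nullary.Decidable using (map′; dec⇒maybe)
open import Relation.Unary using (Pred; _∈_)

-- The convention `B_1 = 1/2` comes from the backward difference. With P(z) - P(z - 1) = z^a the
-- telescoping power is (z + 1)^(a+1) - 1, whose linear coefficient a + 1 is the right side of the
-- recurrence. A forward difference would put z^(a+1) there, with linear coefficient 0 for a > 0,
-- and lead to -1/2. The shift axiom supplies only a limit. It becomes an equation because x^a may
-- serve as its own approximation, with error exactly 0, and because a constant sequence equals its
-- limit. The essence is a complex limit, so P is carried as z (b + z q(z)) with q a polynomial
-- function: boundedness of q near 0 gives the limit b. Linear combinations preserve this form and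
-- act linearly on b, so the identity between the polynomials becomes the recurrence without any
-- comparison of coefficients. Moduli enter only as squares, so no square root is ever taken.

-- Abstract rings have no decidable equality that computes, so the solver
-- gets its coefficients from ℤ.
module IntegerCoefficientSolver {c ℓ} (R : CommutativeRing c ℓ) where
  open CommutativeRing R renaming (refl to ≈-refl; sym to ≈-sym; trans to ≈-trans)
  open SetoidReasoning setoid
  -- With these multiples `1 · 1#` computes to `1#`, so `con (+ 0)` and `con (+ 1)` denote exactly
  -- `0#` and `1#` in solver goals.
  open OptimisedMultiples semiring using (1+×; ×-homo-+; ×1-homo-*) renaming (_×_ to _·_)
  open RingProperties ring using (-‿distribˡ-*; -‿distribʳ-*)
  open AbelianGroupProperties +-abelianGroup
    using () renaming (⁻¹-∙-comm to -‿+-comm; ⁻¹-involutive to -‿involutive; ε⁻¹≈ε to -0≈0)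
  open CommutativeSemigroupProperties +-commutativeSemigroup using (interchange)

  fromℤ : ℤ → Carrier
  fromℤ (+ n)    = n · 1#
  fromℤ -[1+ n ] = - (suc n · 1#)

  fromℤ-neg : ∀ i → fromℤ (ℤ.- i) ≈ - fromℤ i
  fromℤ-neg (+ zero)  = ≈-sym -0≈0
  fromℤ-neg (+ suc n) = ≈-refl
  fromℤ-neg -[1+ n ]  = ≈-sym (-‿involutive _)

  -- Passing to successors on both sides adds `1# - 1#`, which is zero.
  fromℤ-⊖ : ∀ m n → fromℤ (m ⊖ n) ≈ m · 1# - n · 1#
  fromℤ-⊖ m zero = ≈-sym (≈-trans (+-congˡ -0≈0) (+-identityʳ _))
  fromℤ-⊖ zero (suc n) = ≈-sym (+-identityˡ _)
  fromℤ-⊖ (suc m) (suc n) = begin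
    fromℤ (suc m ⊖ suc n)                ≡⟨ cong fromℤ (ℤ.[1+m]⊖[1+n]≡m⊖n m n) ⟩
    fromℤ (m ⊖ n)                        ≈⟨ fromℤ-⊖ m n ⟩
    m · 1# - n · 1#                      ≈⟨ +-identityˡ _ ⟨
    0# + (m · 1# - n · 1#)               ≈⟨ +-congʳ (-‿inverseʳ 1#) ⟨
    1# - 1# + (m · 1# - n · 1#)          ≈⟨ interchange _ _ _ _ ⟩
    1# + m · 1# + (- 1# - n · 1#)        ≈⟨ +-cong (≈-sym (1+× m 1#)) (-‿+-comm _ _) ⟩
    suc m · 1# - (1# + n · 1#)           ≈⟨ +-congˡ (-‿cong (1+× n 1#)) ⟨
    suc m · 1# - suc n · 1#              ∎

  fromℤ-+ : ∀ i j → fromℤ (i ℤ.+ j) ≈ fromℤ i + fromℤ j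
  fromℤ-+ (+ m)    (+ n)    = ×-homo-+ 1# m n
  fromℤ-+ (+ m)    -[1+ n ] = fromℤ-⊖ m (suc n)
  fromℤ-+ -[1+ m ] (+ n)    = ≈-trans (fromℤ-⊖ n (suc m)) (+-comm _ _)
  fromℤ-+ -[1+ m ] -[1+ n ] = begin
    - ((2 ℕ.+ (m ℕ.+ n)) · 1#)        ≡⟨ cong (λ k → - (k · 1#)) (cong suc (ℕ.+-suc m n)) ⟨
    - ((suc m ℕ.+ suc n) · 1#)        ≈⟨ -‿cong (×-homo-+ 1# (suc m) (suc n)) ⟩
    - (suc m · 1# + suc n · 1#)       ≈⟨ -‿+-comm _ _ ⟨
    - (suc m · 1#) - suc n · 1#       ∎

  fromℤ-* : ∀ i j → fromℤ (i ℤ.* j) ≈ fromℤ i * fromℤ j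
  fromℤ-* (+ m) (+ n) = ≈-trans (reflexive (cong fromℤ (ℤ.+◃n≡+n (m ℕ.* n)))) (×1-homo-* m n)
  fromℤ-* (+ m) -[1+ n ] = begin
    fromℤ (+ m ℤ.* -[1+ n ])           ≡⟨ cong fromℤ (ℤ.-◃n≡-n (m ℕ.* suc n)) ⟩
    fromℤ (ℤ.- (+ (m ℕ.* suc n)))      ≈⟨ fromℤ-neg (+ (m ℕ.* suc n)) ⟩
    - ((m ℕ.* suc n) · 1#)             ≈⟨ -‿cong (×1-homo-* m (suc n)) ⟩
    - (m · 1# * suc n · 1#)            ≈⟨ -‿distribʳ-* _ _ ⟩
    m · 1# * - (suc n · 1#)            ∎
  fromℤ-* -[1+ m ] (+ n) = begin
    fromℤ (-[1+ m ] ℤ.* + n)           ≡⟨ cong fromℤ (ℤ.-◃n≡-n (suc m ℕ.* n)) ⟩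
    fromℤ (ℤ.- (+ (suc m ℕ.* n)))      ≈⟨ fromℤ-neg (+ (suc m ℕ.* n)) ⟩
    - ((suc m ℕ.* n) · 1#)             ≈⟨ -‿cong (×1-homo-* (suc m) n) ⟩
    - (suc m · 1# * n · 1#)            ≈⟨ -‿distribˡ-* _ _ ⟩
    - (suc m · 1#) * n · 1#            ∎
  fromℤ-* -[1+ m ] -[1+ n ] = begin
    (suc m ℕ.* suc n) · 1#             ≈⟨ ×1-homo-* (suc m) (suc n) ⟩
    suc m · 1# * suc n · 1#            ≈⟨ -‿involutive _ ⟨
    - - (suc m · 1# * suc n · 1#)      ≈⟨ -‿cong (-‿distribˡ-* _ _) ⟩
    - (- (suc m · 1#) * suc n · 1#)    ≈⟨ -‿distribʳ-* _ _ ⟩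
    - (suc m · 1#) * - (suc n · 1#)    ∎

  private
    almostCommutativeRing : ACR.AlmostCommutativeRing c ℓ
    almostCommutativeRing = ACR.fromCommutativeRing R

    fromℤ-morphism : ℤ.+-*-rawRing ACR.-Raw-AlmostCommutative⟶ almostCommutativeRing
    fromℤ-morphism = record
      { ⟦_⟧    = fromℤ
      ; +-homo = fromℤ-+
      ; *-homo = fromℤ-*
      ; -‿homo = fromℤ-neg
      ; 0-homo = ≈-refl
      ; 1-homo = ≈-refl
      }

    fromℤ-weaklyDecidable : ∀ i j → Maybe (fromℤ i ≈ fromℤ j)
    fromℤ-weaklyDecidable i j =
      Maybe.map (λ i≡j → reflexive (cong fromℤ i≡j)) (dec⇒maybe (i ℤ.≟ j))

  open RingSolver ℤ.+-*-rawRing almostCommutativeRing fromℤ-morphism fromℤ-weaklyDecidable public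
    using (solve; _:=_; _:+_; _:*_; _:-_; :-_; con)

-- Inequalities in an ordered field.

module OrderedFieldProperties (ℝ : CompleteOrderedField) where
  open CompleteOrderedField ℝ

  commutativeRing : CommutativeRing 0ℓ 0ℓ
  commutativeRing = record { isCommutativeRing = isCommutativeRing }

  strictTotalOrder : StrictTotalOrder 0ℓ 0ℓ 0ℓ
  strictTotalOrder = record { isStrictTotalOrder = isStrictTotalOrder }

  open CommutativeRing commutativeRing public
    using (+-comm; +-identityˡ; *-assoc; *-comm; *-identityˡ; *-identityʳ; zeroˡ; zeroʳ; -‿inverseʳ)
  open StrictTotalOrder strictTotalOrder public
    using (compare; _≟_; strictPartialOrder) renaming (trans to <-trans; irrefl to <-irrefl; asym to <-asym)
  open StrictToNonStrict _≡_ _<_ public using (_≤_)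
  open IntegerCoefficientSolver commutativeRing public

  x<y⇒0<y-x : ∀ {x y} → x < y → 0# < y + - x
  x<y⇒0<y-x {x} x<y = subst (_< _) (-‿inverseʳ x) (+-monoˡ-< (- x) x<y)

  0<y-x⇒x<y : ∀ {x y} → 0# < y + - x → x < y
  0<y-x⇒x<y {x} {y} 0<y-x = subst₂ _<_ (+-identityˡ x)
    (solve 2 (λ x y → y :+ :- x :+ x := y) refl x y) (+-monoˡ-< x 0<y-x)

  x<0⇒0<-x : ∀ {x} → x < 0# → 0# < - x
  x<0⇒0<-x {x} x<0 = subst (0# <_) (+-identityˡ (- x)) (x<y⇒0<y-x x<0)

  +-monoˡ-≤ : ∀ {x y} z → x ≤ y → x + z ≤ y + z
  +-monoˡ-≤ z (inj₁ x<y) = inj₁ (+-monoˡ-< z x<y)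
  +-monoˡ-≤ z (inj₂ x≡y) = inj₂ (cong (_+ z) x≡y)

  +-monoʳ-≤ : ∀ {x y} z → x ≤ y → z + x ≤ z + y
  +-monoʳ-≤ z = subst₂ _≤_ (+-comm _ z) (+-comm _ z) ∘ +-monoˡ-≤ z

  *-monoˡ-< : ∀ {x y} z → 0# < z → x < y → x * z < y * z
  *-monoˡ-< {x} {y} z 0<z x<y = 0<y-x⇒x<y (subst (0# <_)
    (solve 3 (λ x y z → (y :+ :- x) :* z := y :* z :+ :- (x :* z)) refl x y z)
    (*-pos (x<y⇒0<y-x x<y) 0<z))

  *-monoˡ-≤ : ∀ {x y} z → 0# ≤ z → x ≤ y → x * z ≤ y * z
  *-monoˡ-≤ z (inj₁ 0<z) (inj₁ x<y)  = inj₁ (*-monoˡ-< z 0<z x<y)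
  *-monoˡ-≤ _ (inj₂ refl) (inj₁ _)   = inj₂ (trans (zeroʳ _) (sym (zeroʳ _)))
  *-monoˡ-≤ z _          (inj₂ refl) = inj₂ refl

  *-monoʳ-≤ : ∀ {x y} z → 0# ≤ z → x ≤ y → z * x ≤ z * y
  *-monoʳ-≤ z 0≤z = subst₂ _≤_ (*-comm _ z) (*-comm _ z) ∘ *-monoˡ-≤ z 0≤z

  x≢0⇒0<x² : ∀ {x} → x ≢ 0# → 0# < x * x
  x≢0⇒0<x² {x} x≢0 with compare x 0#
  ... | tri< x<0 _ _ = subst (0# <_) (solve 1 (λ x → :- x :* :- x := x :* x) refl x)
                         (*-pos (x<0⇒0<-x x<0) (x<0⇒0<-x x<0))
  ... | tri≈ _ x≡0 _ = contradiction x≡0 x≢0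
  ... | tri> _ _ 0<x = *-pos 0<x 0<x

  0≤x² : ∀ x → 0# ≤ x * x
  0≤x² x with compare x 0#
  ... | tri< _ x≢0 _ = inj₁ (x≢0⇒0<x² x≢0)
  ... | tri≈ _ x≡0 _ = inj₂ (sym (trans (cong (_* x) x≡0) (zeroˡ x)))
  ... | tri> _ x≢0 _ = inj₁ (x≢0⇒0<x² x≢0)

  0<1 : 0# < 1#
  0<1 = subst (0# <_) (*-identityˡ 1#) (x≢0⇒0<x² (0≢1 ∘ sym))

  open StrictReasoning strictPartialOrder

  +-pos-nonneg : ∀ {x y} → 0# < x → 0# ≤ y → 0# < x + y
  +-pos-nonneg {x} {y} 0<x 0≤y = begin-strict
    0#       ≤⟨ 0≤y ⟩
    y        ≡⟨ +-identityˡ y ⟨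
    0# + y   <⟨ +-monoˡ-< y 0<x ⟩
    x + y    ∎

  +-nonneg : ∀ {x y} → 0# ≤ x → 0# ≤ y → 0# ≤ x + y
  +-nonneg {x} {y} 0≤x 0≤y = begin
    0#       ≤⟨ 0≤y ⟩
    y        ≡⟨ +-identityˡ y ⟨
    0# + y   ≤⟨ +-monoˡ-≤ y 0≤x ⟩
    x + y    ∎

  ⁻¹-pos : ∀ {x} → 0# < x → 0# < x ⁻¹
  ⁻¹-pos {x} 0<x with compare 0# (x ⁻¹)
  ... | tri< 0<x⁻¹ _ _ = 0<x⁻¹
  ... | tri≈ _ 0≡x⁻¹ _ = contradiction
    (trans (sym (zeroʳ x)) (trans (cong (x *_) 0≡x⁻¹) (⁻¹-inverseʳ λ x≡0 → <-irrefl (sym x≡0) 0<x))) 0≢1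
  ... | tri> _ _ x⁻¹<0 = contradiction
    (begin-strict
      1#           ≡⟨ ⁻¹-inverseʳ (λ x≡0 → <-irrefl (sym x≡0) 0<x) ⟨
      x * x ⁻¹     ≡⟨ *-comm x (x ⁻¹) ⟩
      x ⁻¹ * x     <⟨ *-monoˡ-< x 0<x x⁻¹<0 ⟩
      0# * x       ≡⟨ zeroˡ x ⟩
      0#           ∎)
    (<-asym 0<1)

  -- A substitute for the square root: the smaller of `s` and 1 works, since a positive number below
  -- 1 exceeds its square.
  squareBelow : ∀ {s} → 0# < s → ∃[ r ] 0# < r × r * r ≤ s × r * r ≤ 1#
  squareBelow {s} 0<s with compare s 1#
  ... | tri< s<1 _ _ = s , 0<s , s²≤s , (begin
          s * s   ≤⟨ s²≤s ⟩
          s       <⟨ s<1 ⟩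
          1#      ∎)
    where
    s²≤s : s * s ≤ s
    s²≤s = begin
      s * s    <⟨ *-monoˡ-< s 0<s s<1 ⟩
      1# * s   ≡⟨ *-identityˡ s ⟩
      s        ∎
  ... | tri≈ _ s≡1 _ = 1# , 0<1 , inj₂ (trans (*-identityˡ 1#) (sym s≡1)) , inj₂ (*-identityˡ 1#)
  ... | tri> _ _ 1<s = 1# , 0<1 , inj₁ (subst (_< s) (sym (*-identityˡ 1#)) 1<s) , inj₂ (*-identityˡ 1#)

-- The field of complex numbers and the squared modulus.

module ComplexField (ℝ : CompleteOrderedField) where
  open FractionalSums ℝ
  private
    module ℝ where
      open CompleteOrderedField ℝ public
      open OrderedFieldProperties ℝ public

  ℂ-isCommutativeRing : IsCommutativeRing _≡_ _+_ _*_ -_ 0# 1#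
  ℂ-isCommutativeRing = record
    { isRing = record
      { +-isAbelianGroup = record
        { isGroup = record
          { isMonoid = record
            { isSemigroup = record
              { isMagma = record { isEquivalence = isEquivalence ; ∙-cong = cong₂ _+_ }
              ; assoc = λ { (a +i b) (c +i d) (e +i f) → cong₂ _+i_ (+-assoc a c e) (+-assoc b d f) }
              }
            ; identity = (λ { (a +i b) → cong₂ _+i_ (+-identityˡ a) (+-identityˡ b) })
                       , (λ { (a +i b) → cong₂ _+i_ (+-identityʳ a) (+-identityʳ b) })
            }
          ; inverse = (λ { (a +i b) → cong₂ _+i_ (-‿inverseˡ a) (-‿inverseˡ b) })
                    , (λ { (a +i b) → cong₂ _+i_ (-‿inverseʳ a) (-‿inverseʳ b) })
          ; ⁻¹-cong = cong (λ z → - z)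
          }
        ; comm = λ { (a +i b) (c +i d) → cong₂ _+i_ (+-comm a c) (+-comm b d) }
        }
      ; *-cong = cong₂ _*_
      ; *-assoc = λ { (a +i b) (c +i d) (e +i f) → cong₂ _+i_
          (ℝ.solve 6 (λ a b c d e f →
            (a :* c :- b :* d) :* e :- (a :* d :+ b :* c) :* f
              := a :* (c :* e :- d :* f) :- b :* (c :* f :+ d :* e)) refl a b c d e f)
          (ℝ.solve 6 (λ a b c d e f →
            (a :* c :- b :* d) :* f :+ (a :* d :+ b :* c) :* e
              := a :* (c :* f :+ d :* e) :+ b :* (c :* e :- d :* f)) refl a b c d e f) }
      ; *-identity = (λ z → trans (*-comm 1# z) (*-identityʳ z)) , *-identityʳ
      ; distrib = *-distribˡ-+ , λ z w v →
          trans (*-comm (w + v) z) (trans (*-distribˡ-+ z w v) (cong₂ _+_ (*-comm z w) (*-comm z v)))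
      }
    ; *-comm = *-comm
    }
    where
    open CommutativeRing ℝ.commutativeRing
      using (+-assoc; +-identityˡ; +-identityʳ; -‿inverseˡ; -‿inverseʳ; +-comm)
    open ℝ using (_:=_; _:+_; _:*_; _:-_)

    *-comm : ∀ z w → z * w ≡ w * z
    *-comm (a +i b) (c +i d) = cong₂ _+i_
      (ℝ.solve 4 (λ a b c d → a :* c :- b :* d := c :* a :- d :* b) refl a b c d)
      (ℝ.solve 4 (λ a b c d → a :* d :+ b :* c := c :* b :+ d :* a) refl a b c d)

    *-identityʳ : ∀ z → z * 1# ≡ z
    *-identityʳ (a +i b) = cong₂ _+i_
      (ℝ.solve 2 (λ a b → a :* ℝ.con (+ 1) :- b :* ℝ.con (+ 0) := a) refl a b)
      (ℝ.solve 2 (λ a b → a :* ℝ.con (+ 0) :+ b :* ℝ.con (+ 1) := b) refl a b)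

    *-distribˡ-+ : ∀ z w v → z * (w + v) ≡ z * w + z * v
    *-distribˡ-+ (a +i b) (c +i d) (e +i f) = cong₂ _+i_
      (ℝ.solve 6 (λ a b c d e f → a :* (c :+ e) :- b :* (d :+ f)
        := (a :* c :- b :* d) :+ (a :* e :- b :* f)) refl a b c d e f)
      (ℝ.solve 6 (λ a b c d e f → a :* (d :+ f) :+ b :* (c :+ e)
        := (a :* d :+ b :* c) :+ (a :* f :+ b :* e)) refl a b c d e f)

  ℂ-commutativeRing : CommutativeRing 0ℓ 0ℓ
  ℂ-commutativeRing = record { isCommutativeRing = ℂ-isCommutativeRing }

  open CommutativeRing ℂ-commutativeRing public
    using (+-identityˡ; +-identityʳ; *-comm; *-identityˡ; *-identityʳ; *-assoc;
           semiring; commutativeSemiring; ring)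

  infix 4 _≟_

  _≟_ : DecidableEquality ℂ
  (a +i b) ≟ (c +i d) = map′ (uncurry (cong₂ _+i_)) (λ z≡w → cong re z≡w , cong im z≡w)
    (a ℝ.≟ c ×-dec b ℝ.≟ d)

  -- The two-square identity of Brahmagupta and Fibonacci.
  normSq-* : ∀ z w → normSq (z * w) ≡ normSq z ℝ.* normSq w
  normSq-* (a +i b) (c +i d) = ℝ.solve 4 (λ a b c d →
    (a :* c :- b :* d) :* (a :* c :- b :* d) :+ (a :* d :+ b :* c) :* (a :* d :+ b :* c)
      := (a :* a :+ b :* b) :* (c :* c :+ d :* d)) refl a b c d
    where open ℝ using (_:=_; _:+_; _:*_; _:-_)

  normSq-nonneg : ∀ z → ℝ.0# ℝ.≤ normSq z
  normSq-nonneg (a +i b) = ℝ.+-nonneg (ℝ.0≤x² a) (ℝ.0≤x² b)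

  normSq-pos : ∀ {z} → z ≢ 0# → ℝ.0# ℝ.< normSq z
  normSq-pos {a +i b} z≢0 with a ℝ.≟ ℝ.0# | b ℝ.≟ ℝ.0#
  ... | yes a≡0 | yes b≡0 = contradiction (cong₂ _+i_ a≡0 b≡0) z≢0
  ... | no  a≢0 | _       = ℝ.+-pos-nonneg (ℝ.x≢0⇒0<x² a≢0) (ℝ.0≤x² b)
  ... | yes _   | no b≢0  = subst (ℝ.0# ℝ.<_) (ℝ.+-comm _ _) (ℝ.+-pos-nonneg (ℝ.x≢0⇒0<x² b≢0) (ℝ.0≤x² a))

  -- Replaces the triangle inequality: in the parallelogram law the square of `z - w` is dropped.
  -- The lost factor 2 is harmless where only some finite bound is wanted.
  normSq-+-≤ : ∀ z w → normSq (z + w) ℝ.≤ (normSq z ℝ.+ normSq z) ℝ.+ (normSq w ℝ.+ normSq w)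
  normSq-+-≤ z@(a +i b) w@(c +i d) = begin
    normSq (z + w)                         ≡⟨ ℝ.+-identityˡ _ ⟨
    ℝ.0# ℝ.+ normSq (z + w)                ≤⟨ ℝ.+-monoˡ-≤ _ (normSq-nonneg (z - w)) ⟩
    normSq (z - w) ℝ.+ normSq (z + w)      ≡⟨ parallelogram ⟩
    (normSq z ℝ.+ normSq z) ℝ.+ (normSq w ℝ.+ normSq w) ∎
    where
    open StrictReasoning ℝ.strictPartialOrder
    open ℝ using (_:=_; _:+_; _:*_; _:-_)
    parallelogram : normSq (z - w) ℝ.+ normSq (z + w) ≡
                    (normSq z ℝ.+ normSq z) ℝ.+ (normSq w ℝ.+ normSq w)
    parallelogram = ℝ.solve 4 (λ a b c d →
      ((a :- c) :* (a :- c) :+ (b :- d) :* (b :- d)) :+ ((a :+ c) :* (a :+ c) :+ (b :+ d) :* (b :+ d))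
        := ((a :* a :+ b :* b) :+ (a :* a :+ b :* b)) :+ ((c :* c :+ d :* d) :+ (c :* c :+ d :* d)))
      refl a b c d

  -- The second factor in the definition of `_/_`, so `z / w` unfolds to `z * reciprocal w`.
  reciprocal : ℂ → ℂ
  reciprocal w = (re w ℝ.* normSq w ℝ.⁻¹) +i (ℝ.- im w ℝ.* normSq w ℝ.⁻¹)

  reciprocal-inverseˡ : ∀ {w} → w ≢ 0# → reciprocal w * w ≡ 1#
  reciprocal-inverseˡ {w@(a +i b)} w≢0 = cong₂ _+i_
    (trans
      (ℝ.solve 3 (λ a b n → (a :* n) :* a :- (:- b :* n) :* b := (a :* a :+ b :* b) :* n)
        refl a b (normSq w ℝ.⁻¹))
      (ℝ.⁻¹-inverseʳ λ N≡0 → ℝ.<-irrefl (sym N≡0) (normSq-pos w≢0)))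
    (ℝ.solve 3 (λ a b n → (a :* n) :* b :+ (:- b :* n) :* a := ℝ.con (+ 0))
      refl a b (normSq w ℝ.⁻¹))
    where open ℝ using (_:=_; _:+_; _:*_; _:-_; :-_)

  -- Characteristic zero comes from the order: the real part is 1 plus something nonnegative.
  ι-suc≢0 : ∀ n → ι (suc n) ≢ 0#
  ι-suc≢0 n ι≡0 = ℝ.<-irrefl (sym (cong re ι≡0)) (ℝ.+-pos-nonneg ℝ.0<1 (re-ι-nonneg n))
    where
    re-ι-nonneg : ∀ n → ℝ.0# ℝ.≤ re (ι n)
    re-ι-nonneg zero    = inj₂ refl
    re-ι-nonneg (suc n) = inj₁ (ℝ.+-pos-nonneg ℝ.0<1 (re-ι-nonneg n))

  1≢0 : 1# ≢ 0#
  1≢0 1≡0 = ℝ.0≢1 (sym (cong re 1≡0))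

lookup-∷ʳ-fromℕ : ∀ {A : Set} {n} (xs : Vec A n) x → lookup (xs ∷ʳ x) (fromℕ n) ≡ x
lookup-∷ʳ-fromℕ Vec.[]       x = refl
lookup-∷ʳ-fromℕ (_ Vec.∷ xs) x = lookup-∷ʳ-fromℕ xs x

lookup-∷ʳ-inject₁ : ∀ {A : Set} {n} (xs : Vec A n) x i → lookup (xs ∷ʳ x) (inject₁ i) ≡ lookup xs i
lookup-∷ʳ-inject₁ (_ Vec.∷ xs) x zero    = refl
lookup-∷ʳ-inject₁ (_ Vec.∷ xs) x (suc i) = lookup-∷ʳ-inject₁ xs x i

-- Polynomial functions, limits, and expansions at the origin.

module PolynomialFunctions (ℝ : CompleteOrderedField) where
  open FractionalSums ℝ
  open ComplexField ℝ
  open IntegerCoefficientSolver ℂ-commutativeRing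
  open SumProperties semiring using (sum-cong-≗; *-distribˡ-sum)
  open RingProperties ring using (x∙y⁻¹≈ε⇒x≈y; x≈y⇒x∙y⁻¹≈ε)
  private
    module ℝ where
      open CompleteOrderedField ℝ public
      open OrderedFieldProperties ℝ public

  -- Horner form, with no degree in the type: sums and translates then need no padding of
  -- coefficient vectors. `coefficients` recovers a vector where `IsPolynomialSum` asks for one.
  data Polynomial : Fun → Set where
    const  : ∀ {f} c → (∀ z → f z ≡ c) → Polynomial f
    horner : ∀ {f g} c → Polynomial g → (∀ z → f z ≡ c + z * g z) → Polynomial f

  Polynomial-cong : ∀ {f g} → f ≗ g → Polynomial f → Polynomial g
  Polynomial-cong f≗g (const c f≗c)      = const c λ z → trans (sym (f≗g z)) (f≗c z)
  Polynomial-cong f≗g (horner c h f≗c+h) = horner c h λ z → trans (sym (f≗g z)) (f≗c+h z)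

  Polynomial-+ : ∀ {f g} → Polynomial f → Polynomial g → Polynomial (λ z → f z + g z)
  Polynomial-+ (const c f≗) (const d g≗) = const (c + d) λ z → cong₂ _+_ (f≗ z) (g≗ z)
  Polynomial-+ (const c f≗) (horner d q g≗) = horner (c + d) q λ z → trans (cong₂ _+_ (f≗ z) (g≗ z))
    (solve 4 (λ c d z q → c :+ (d :+ z :* q) := c :+ d :+ z :* q) refl c d z _)
  Polynomial-+ (horner c p f≗) (const d g≗) = horner (c + d) p λ z → trans (cong₂ _+_ (f≗ z) (g≗ z))
    (solve 4 (λ c d z p → c :+ z :* p :+ d := c :+ d :+ z :* p) refl c d z _)
  Polynomial-+ (horner c p f≗) (horner d q g≗) =
    horner (c + d) (Polynomial-+ p q) λ z → trans (cong₂ _+_ (f≗ z) (g≗ z))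
      (solve 5 (λ c d z p q → c :+ z :* p :+ (d :+ z :* q) := c :+ d :+ z :* (p :+ q)) refl c d z _ _)

  Polynomial-scale : ∀ {f} c → Polynomial f → Polynomial (λ z → c * f z)
  Polynomial-scale c (const d f≗)    = const (c * d) λ z → cong (c *_) (f≗ z)
  Polynomial-scale c (horner d p f≗) = horner (c * d) (Polynomial-scale c p) λ z →
    trans (cong (c *_) (f≗ z))
      (solve 4 (λ c d z p → c :* (d :+ z :* p) := c :* d :+ z :* (c :* p)) refl c d z _)

  Polynomial-shift : ∀ {f} s → Polynomial f → Polynomial (shift f s)
  Polynomial-shift s (const c f≗)    = const c λ z → f≗ (z + s)
  Polynomial-shift s (horner c p f≗) =
    -- The factor `z + s` is split: the part with `z` is again a Horner step, the part with `s` a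
    -- scalar multiple.
    Polynomial-cong
      (λ z → trans
        (solve 4 (λ c z s p → c :+ z :* p :+ s :* p := c :+ (z :+ s) :* p) refl c z s _)
        (sym (f≗ (z + s))))
      (Polynomial-+ (horner c (Polynomial-shift s p) λ _ → refl)
                    (Polynomial-scale s (Polynomial-shift s p)))

  eval-∷ : ∀ {d} c (p : Poly d) z → eval (c ∷ p) z ≡ c + z * eval p z
  eval-∷ c p z = cong₂ _+_ (*-identityʳ c) (begin
    sum (λ i → p i * (z * z ^ toℕ i))    ≡⟨ sum-cong-≗ (λ i →
      solve 3 (λ a z w → a :* (z :* w) := z :* (a :* w)) refl (p i) z (z ^ toℕ i)) ⟩
    sum (λ i → z * (p i * z ^ toℕ i))    ≡⟨ *-distribˡ-sum z (λ i → p i * z ^ toℕ i) ⟨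
    z * eval p z                         ∎)
    where open ≡-Reasoning

  coefficients : ∀ {f} → Polynomial f → ∃[ d ] Σ[ p ∈ Poly d ] eval p ≗ f
  coefficients (const c f≗) = 0 , (λ _ → c) , λ z →
    trans (+-identityʳ _) (trans (*-identityʳ c) (sym (f≗ z)))
  coefficients (horner c g f≗) with coefficients g
  ... | d , p , p≗ = suc d , c ∷ p , λ z →
    trans (eval-∷ c p z) (trans (cong (λ w → c + z * w) (p≗ z)) (sym (f≗ z)))

  monomial : ∀ a → Poly a
  monomial zero    = λ _ → 1#
  monomial (suc a) = 0# ∷ monomial a

  eval-monomial : ∀ a z → eval (monomial a) z ≡ z ^ a
  eval-monomial zero z = trans (+-identityʳ _) (*-identityʳ 1#)
  eval-monomial (suc a) z =
    trans (eval-∷ 0# (monomial a) z) (trans (+-identityˡ _) (cong (z *_) (eval-monomial a z)))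

  -- Shows that the degree is exactly `a`, as `FixedDegree` requires.
  monomial-leading : ∀ a → monomial a (fromℕ a) ≡ 1#
  monomial-leading zero    = refl
  monomial-leading (suc a) = monomial-leading a

  -- `M` bounds the squared modulus. On the unit disc the factor `z` of a Horner step does not
  -- enlarge moduli, so a bound follows by induction instead of compactness.
  BoundedOnDisc : Fun → Set
  BoundedOnDisc f = ∃[ M ] ℝ.0# ℝ.< M × (∀ z → normSq z ℝ.< ℝ.1# → normSq (f z) ℝ.< M)

  private
    double-< : ∀ {x y} → x ℝ.< y → x ℝ.+ x ℝ.< y ℝ.+ y
    double-< {x} {y} x<y = begin-strict
      x ℝ.+ x   <⟨ ℝ.+-monoˡ-< x x<y ⟩
      y ℝ.+ x   ≤⟨ ℝ.+-monoʳ-≤ y (inj₁ x<y) ⟩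
      y ℝ.+ y   ∎
      where open StrictReasoning ℝ.strictPartialOrder

  polynomial-bounded : ∀ {f} → Polynomial f → BoundedOnDisc f
  polynomial-bounded (const c f≗) =
    ℝ.1# ℝ.+ normSq c , ℝ.+-pos-nonneg ℝ.0<1 (normSq-nonneg c) , λ z _ →
    subst₂ ℝ._<_ (trans (ℝ.+-identityˡ _) (cong normSq (sym (f≗ z)))) refl (ℝ.+-monoˡ-< (normSq c) ℝ.0<1)
  polynomial-bounded {f} (horner {g = g} c p f≗) with polynomial-bounded p
  ... | M , 0<M , bound =
      -- From |c + z g|² ≤ 2|c|² + 2|z g|² and |z g|² < M.
      (M ℝ.+ M) ℝ.+ (normSq c ℝ.+ normSq c)
    , ℝ.+-pos-nonneg (ℝ.+-pos-nonneg 0<M (inj₁ 0<M)) (ℝ.+-nonneg (normSq-nonneg c) (normSq-nonneg c))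
    , λ z ∣z∣<1 → begin-strict
        normSq (f z)
          ≡⟨ cong normSq (f≗ z) ⟩
        normSq (c + z * g z)
          ≤⟨ normSq-+-≤ c (z * g z) ⟩
        (normSq c ℝ.+ normSq c) ℝ.+ (normSq (z * g z) ℝ.+ normSq (z * g z))
          ≡⟨ ℝ.+-comm _ _ ⟩
        (normSq (z * g z) ℝ.+ normSq (z * g z)) ℝ.+ (normSq c ℝ.+ normSq c)
          <⟨ ℝ.+-monoˡ-< _ (double-< (zg-bound z ∣z∣<1)) ⟩
        (M ℝ.+ M) ℝ.+ (normSq c ℝ.+ normSq c)
          ∎
    where
    open StrictReasoning ℝ.strictPartialOrder
    zg-bound : ∀ z → normSq z ℝ.< ℝ.1# → normSq (z * g z) ℝ.< M
    zg-bound z ∣z∣<1 = begin-strict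
      normSq (z * g z)             ≡⟨ normSq-* z (g z) ⟩
      normSq z ℝ.* normSq (g z)    ≤⟨ ℝ.*-monoˡ-≤ _ (normSq-nonneg (g z)) (inj₁ ∣z∣<1) ⟩
      ℝ.1# ℝ.* normSq (g z)        ≡⟨ ℝ.*-identityˡ _ ⟩
      normSq (g z)                 <⟨ bound z ∣z∣<1 ⟩
      M                            ∎

  limitAtOrigin : ∀ {f g b} → BoundedOnDisc f → (∀ h → h ≢ 0# → g h - b ≡ h * f h) → g ⟶₀ b
  limitAtOrigin {f} {g} {b} (M , 0<M , bound) g-b≡hf ε 0<ε
    -- δ² ≤ ε²/M makes |h f(h)| smaller than ε, and δ² ≤ 1 keeps h in the disc on which `M` is a
    -- bound.
    with ℝ.squareBelow (ℝ.*-pos (ℝ.*-pos 0<ε 0<ε) (ℝ.⁻¹-pos 0<M))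
  ... | δ , 0<δ , δ²≤ε²/M , δ²≤1 = δ , 0<δ , λ h h≢0 ∣h∣<δ → begin-strict
    normSq (g h - b)                ≡⟨ cong normSq (g-b≡hf h h≢0) ⟩
    normSq (h * f h)                ≡⟨ normSq-* h (f h) ⟩
    normSq h ℝ.* normSq (f h)       ≤⟨ ℝ.*-monoʳ-≤ _ (normSq-nonneg h) (inj₁ (f-bound h ∣h∣<δ)) ⟩
    normSq h ℝ.* M                  <⟨ ℝ.*-monoˡ-< M 0<M ∣h∣<δ ⟩
    (δ ℝ.* δ) ℝ.* M                 ≤⟨ ℝ.*-monoˡ-≤ M (inj₁ 0<M) δ²≤ε²/M ⟩
    ((ε ℝ.* ε) ℝ.* M ℝ.⁻¹) ℝ.* M    ≡⟨ ε²/M*M≡ε² ⟩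
    ε ℝ.* ε                         ∎
    where
    open StrictReasoning ℝ.strictPartialOrder

    f-bound : ∀ h → ∣ h ∣< δ → normSq (f h) ℝ.< M
    f-bound h ∣h∣<δ = bound h (begin-strict
      normSq h  <⟨ ∣h∣<δ ⟩
      δ ℝ.* δ   ≤⟨ δ²≤1 ⟩
      ℝ.1#      ∎)

    ε²/M*M≡ε² : ((ε ℝ.* ε) ℝ.* M ℝ.⁻¹) ℝ.* M ≡ ε ℝ.* ε
    ε²/M*M≡ε² = trans (ℝ.*-assoc _ _ _) (trans (cong ((ε ℝ.* ε) ℝ.*_)
      (trans (ℝ.*-comm _ M) (ℝ.⁻¹-inverseʳ λ M≡0 → ℝ.<-irrefl (sym M≡0) 0<M))) (ℝ.*-identityʳ _))

  limit-of-constant : ∀ {s l} → (∀ n → s n ≡ l) → s ⟶ l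
  limit-of-constant {s} {l} s≡l ε 0<ε = 0 , λ n _ →
    subst (ℝ._< ε ℝ.* ε)
      (trans (sym normSq-0) (cong normSq (sym (x≈y⇒x∙y⁻¹≈ε (s≡l n)))))
      (ℝ.*-pos 0<ε 0<ε)
    where
    normSq-0 : normSq 0# ≡ ℝ.0#
    normSq-0 = trans (cong₂ ℝ._+_ (ℝ.zeroˡ _) (ℝ.zeroˡ _)) (ℝ.+-identityˡ _)

  -- Equality in ℂ is decidable by trichotomy. If `c` and `l` differ, a tolerance r with r² ≤ |c -
  -- l|² excludes every term.
  constant-limit : ∀ {s l c} → (∀ n → s n ≡ c) → s ⟶ l → c ≡ l
  constant-limit {s} {l} {c} s≡c s⟶l with c ≟ l
  ... | yes c≡l = c≡l
  ... | no  c≢l with ℝ.squareBelow (normSq-pos (c≢l ∘ x∙y⁻¹≈ε⇒x≈y c l))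
  ...   | r , 0<r , r²≤∣c-l∣² , _ with s⟶l r 0<r
  ...     | N , within = contradiction (begin-strict
    normSq (c - l)     ≡⟨ cong (λ w → normSq (w - l)) (s≡c N) ⟨
    normSq (s N - l)   <⟨ within N ℕ.≤-refl ⟩
    r ℝ.* r            ≤⟨ r²≤∣c-l∣² ⟩
    normSq (c - l)     ∎) (ℝ.<-irrefl refl)
    where open StrictReasoning ℝ.strictPartialOrder

  -- An algebraic rendering of f(0) = 0 and f′(0) = b, with a polynomial remainder that stays
  -- bounded near 0.
  record VanishingWithSlope (b : ℂ) (f : Fun) : Set where
    field
      {quotient} : Fun
      polynomial : Polynomial quotient
      factors    : ∀ z → f z ≡ z * (b + z * quotient z)
  open VanishingWithSlope

  slope-cong : ∀ {b f g} → f ≗ g → VanishingWithSlope b f → VanishingWithSlope b g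
  slope-cong f≗g F = record
    { polynomial = polynomial F ; factors = λ z → trans (sym (f≗g z)) (factors F z) }

  slope-0 : VanishingWithSlope 0# (λ _ → 0#)
  slope-0 = record
    { polynomial = const 0# λ _ → refl
    ; factors    = solve 1 (λ z → con (+ 0) := z :* (con (+ 0) :+ z :* con (+ 0))) refl
    }

  slope-+ : ∀ {a b f g} → VanishingWithSlope a f → VanishingWithSlope b g →
            VanishingWithSlope (a + b) (λ z → f z + g z)
  slope-+ {a} {b} F G = record
    { polynomial = Polynomial-+ (polynomial F) (polynomial G)
    ; factors    = λ z → trans (cong₂ _+_ (factors F z) (factors G z))
        (solve 5 (λ a b z p q → z :* (a :+ z :* p) :+ z :* (b :+ z :* q)
          := z :* (a :+ b :+ z :* (p :+ q))) refl a b z _ _)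
    }

  slope-scale : ∀ {b f} c → VanishingWithSlope b f → VanishingWithSlope (c * b) (λ z → c * f z)
  slope-scale {b} c F = record
    { polynomial = Polynomial-scale c (polynomial F)
    ; factors    = λ z → trans (cong (c *_) (factors F z))
        (solve 4 (λ c b z q → c :* (z :* (b :+ z :* q)) := z :* (c :* b :+ z :* (c :* q))) refl c b z _)
    }

  slope-sum : ∀ {n} {b : Fin n → ℂ} {f : Fin n → Fun} → (∀ i → VanishingWithSlope (b i) (f i)) →
              VanishingWithSlope (sum b) (λ z → sum (λ i → f i z))
  slope-sum {zero}  F = slope-0
  slope-sum {suc n} F = slope-+ (F zero) (slope-sum (F ∘ suc))

  -- Induction through (z + 1)^(n+1) - 1 = (z + 1) ((z + 1)^n - 1) + z, where the last `z` raises
  -- the slope by one.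
  slope-power : ∀ n → VanishingWithSlope (ι n) (λ z → (z + 1#) ^ n - 1#)
  slope-power zero = record
    { polynomial = const 0# λ _ → refl
    ; factors    = solve 1 (λ z → con (+ 1) :- con (+ 1) := z :* (con (+ 0) :+ z :* con (+ 0))) refl
    }
  slope-power (suc n) = record
    -- Read off from (z + 1) (n + z q) + 1 = (1 + n) + z (n + q + z q); the `0#` is the constant
    -- coefficient that `horner` demands.
    { polynomial = Polynomial-+ (const (ι n) λ _ → refl)
        (Polynomial-+ (polynomial F) (horner 0# (polynomial F) λ _ → refl))
    ; factors    = λ z → begin
        (z + 1#) * (z + 1#) ^ n - 1#
          ≡⟨ solve 2 (λ z w → (z :+ con (+ 1)) :* w :- con (+ 1)
               := (z :+ con (+ 1)) :* (w :- con (+ 1)) :+ z) refl z ((z + 1#) ^ n) ⟩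
        (z + 1#) * ((z + 1#) ^ n - 1#) + z
          ≡⟨ cong (λ w → (z + 1#) * w + z) (factors F z) ⟩
        (z + 1#) * (z * (ι n + z * quotient F z)) + z
          ≡⟨ solve 3 (λ z m q → (z :+ con (+ 1)) :* (z :* (m :+ z :* q)) :+ z
               := z :* (con (+ 1) :+ m :+ z :* (m :+ (q :+ (con (+ 0) :+ z :* q))))) refl z (ι n) (quotient F z) ⟩
        z * (1# + ι n + z * (ι n + (quotient F z + (0# + z * quotient F z))))
          ∎
    }
    where
    open ≡-Reasoning
    F = slope-power n

  slope⇒Polynomial : ∀ {b f} → VanishingWithSlope b f → Polynomial f
  slope⇒Polynomial {b} F = horner 0# (horner b (polynomial F) λ _ → refl) λ z →
    trans (factors F z) (sym (+-identityˡ _))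

  -- For h ≠ 0 the difference f(h)/h - b is exactly h q(h), with q bounded near 0.
  slope⇒⟶₀ : ∀ {b f} → VanishingWithSlope b f → (λ h → 1# / h * f h) ⟶₀ b
  slope⇒⟶₀ {b} {f} F = limitAtOrigin (polynomial-bounded (polynomial F)) λ h h≢0 → begin
    1# * reciprocal h * f h - b
      ≡⟨ cong (λ w → 1# * reciprocal h * w - b) (factors F h) ⟩
    1# * reciprocal h * (h * (b + h * quotient F h)) - b
      ≡⟨ solve 4 (λ r h b q → con (+ 1) :* r :* (h :* (b :+ h :* q)) :- b
           := r :* h :* (b :+ h :* q) :- b) refl (reciprocal h) h b (quotient F h) ⟩
    reciprocal h * h * (b + h * quotient F h) - b
      ≡⟨ cong (λ w → w * (b + h * quotient F h) - b) (reciprocal-inverseˡ h≢0) ⟩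
    1# * (b + h * quotient F h) - b
      ≡⟨ solve 3 (λ h b q → con (+ 1) :* (b :+ h :* q) :- b := h :* q) refl h b (quotient F h) ⟩
    h * quotient F h
      ∎
    where open ≡-Reasoning

-- Polynomial power sums and the Bernoulli recurrence.

module Faulhaber (ℝ : CompleteOrderedField) where
  open FractionalSums ℝ
  open ComplexField ℝ
  open PolynomialFunctions ℝ
  open IntegerCoefficientSolver ℂ-commutativeRing
  open SumProperties semiring using (sum-cong-≗; sum-init-last)
  open Multiples semiring using (×-assoc-*)
  open ≡-Reasoning

  sum-snoc : ∀ (f : ℕ → ℂ) n → sum {suc n} (f ∘ toℕ) ≡ sum {n} (f ∘ toℕ) + f n
  sum-snoc f n = trans (sum-init-last {n} (f ∘ toℕ))
    (cong₂ _+_ (sum-cong-≗ {n} (cong f ∘ toℕ-inject₁)) (cong f (toℕ-fromℕ n)))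

  sum-‿- : ∀ {n} (s t : Fin n → ℂ) → sum s - sum t ≡ sum (λ i → s i - t i)
  sum-‿- {zero}  s t = solve 0 (con (+ 0) :- con (+ 0) := con (+ 0)) refl
  sum-‿- {suc n} s t = trans
    (solve 4 (λ a b c d → a :+ b :- (c :+ d) := (a :- c) :+ (b :- d)) refl
      (s zero) (sum (s ∘ suc)) (t zero) (sum (t ∘ suc)))
    (cong (λ d → s zero - t zero + d) (sum-‿- (s ∘ suc) (t ∘ suc)))

  1^n≡1 : ∀ n → 1# ^ n ≡ 1#
  1^n≡1 zero    = refl
  1^n≡1 (suc n) = trans (*-identityˡ _) (1^n≡1 n)

  [1+n]Cn≡1+n : ∀ n → suc n C n ≡ suc n
  [1+n]Cn≡1+n n = trans (nCk≡nC[n∸k] (ℕ.n≤1+n n))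
    (trans (cong (suc n C_) (ℕ.m+n∸n≡m 1 n)) (nC1≡n (suc n)))

  binomial-[z+1]^n : ∀ n z → (z + 1#) ^ n ≡ sum {suc n} (λ k → ι (n C toℕ k) * z ^ toℕ k)
  binomial-[z+1]^n n z = trans (Binomial.theorem commutativeSemiring n z 1#)
    (sum-cong-≗ {suc n} λ k → begin
      (n C toℕ k) · (z ^ toℕ k * 1# ^ (n ℕ.∸ toℕ k))
        ≡⟨ cong (λ w → (n C toℕ k) · (z ^ toℕ k * w)) (1^n≡1 (n ℕ.∸ toℕ k)) ⟩
      (n C toℕ k) · (z ^ toℕ k * 1#)
        ≡⟨ cong ((n C toℕ k) ·_) (*-comm _ 1#) ⟩
      (n C toℕ k) · (1# * z ^ toℕ k)
        ≡⟨ ×-assoc-* (n C toℕ k) 1# _ ⟨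
      ι (n C toℕ k) * z ^ toℕ k
        ∎)

  -- In the binomial expansion the top term cancels against `z ^ suc a`; the next one has
  -- coefficient a + 1 and is set apart, because it is the power whose sum is sought.
  power-difference : ∀ a z → (z + 1#) ^ suc a - z ^ suc a ≡
    sum {a} (λ k → ι (suc a C toℕ k) * z ^ toℕ k) + ι (suc a) * z ^ a
  power-difference a z = begin
    (z + 1#) ^ suc a - z ^ suc a
      ≡⟨ cong (_- z ^ suc a) (trans (binomial-[z+1]^n (suc a) z)
           (trans (sum-snoc term (suc a)) (cong (_+ term (suc a)) (sum-snoc term a)))) ⟩
    S + term a + term (suc a) - z ^ suc a
      ≡⟨ cong₂ (λ m n → S + ι m * z ^ a + ι n * z ^ suc a - z ^ suc a) ([1+n]Cn≡1+n a) (nCn≡1 (suc a)) ⟩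
    S + ι (suc a) * z ^ a + ι 1 * z ^ suc a - z ^ suc a
      -- `ι 1` unfolds to `1# + 0#`, hence the coefficient `con (+ 1) :+ con (+ 0)`.
      ≡⟨ solve 3 (λ s t w → s :+ t :+ (con (+ 1) :+ con (+ 0)) :* w :- w := s :+ t) refl
           S (ι (suc a) * z ^ a) (z ^ suc a) ⟩
    S + ι (suc a) * z ^ a
      ∎
    where
    term : ℕ → ℂ
    term k = ι (suc a C k) * z ^ k
    S = sum {a} (term ∘ toℕ)

  -- Tables grow only at their end, so an entry keeps the value with which it was appended.
  lookup-bernoullis : ∀ n k → lookup (bernoullis n) k ≡ bernoulli (toℕ k)
  lookup-bernoullis (suc n) k with view k
  ... | ‵fromℕ     = trans (lookup-∷ʳ-fromℕ (bernoullis n) _) (cong bernoulli (sym (toℕ-fromℕ n)))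
  ... | ‵inject₁ j = trans (lookup-∷ʳ-inject₁ (bernoullis n) _ j)
    (trans (lookup-bernoullis n j) (cong bernoulli (sym (toℕ-inject₁ j))))

  -- The normalisation P(0) = 0 is contained in `slope`.
  record PowerSum (a : ℕ) : Set where
    field
      sumUpTo    : Fun
      slope      : VanishingWithSlope (bernoulli a) sumUpTo
      difference : ∀ z → sumUpTo z - sumUpTo (z - 1#) ≡ z ^ a

  -- (a + 1) P_a(z) = (z + 1)^(a+1) - 1 - ∑_{k<a} (a+1 C k) P_k(z); its linear
  -- coefficients satisfy exactly the recurrence defining the Bernoulli numbers.
  powerSum : ∀ a → PowerSum a
  powerSum = <-rec PowerSum λ a rec → step a λ k → rec (toℕ<n k)
    where
    open PowerSum

    step : ∀ a → ((k : Fin a) → PowerSum (toℕ k)) → PowerSum a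
    step a lower = record
      { sumUpTo    = λ z → r * numerator z
      ; slope      = subst (λ b → VanishingWithSlope b (λ z → r * numerator z)) slope≡bernoulli
          (slope-scale r (slope-+ (slope-power (suc a)) (slope-scale (- 1#) lowerSlope)))
      ; difference = λ z → begin
          r * numerator z - r * numerator (z - 1#)
            ≡⟨ solve 3 (λ r x y → r :* x :- r :* y := r :* (x :- y)) refl r (numerator z) (numerator (z - 1#)) ⟩
          r * (numerator z - numerator (z - 1#))
            ≡⟨ cong (r *_) (numerator-difference z) ⟩
          r * (ι (suc a) * z ^ a)
            ≡⟨ *-assoc r _ _ ⟨
          r * ι (suc a) * z ^ a
            ≡⟨ cong (_* z ^ a) (reciprocal-inverseˡ (ι-suc≢0 a)) ⟩
          1# * z ^ a
            ≡⟨ *-identityˡ _ ⟩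
          z ^ a
            ∎
      }
      where
      r : ℂ
      r = reciprocal (ι (suc a))

      coeff : Fin a → ℂ
      coeff k = ι (suc a C toℕ k)

      lowerSum : Fun
      lowerSum z = sum (λ k → coeff k * sumUpTo (lower k) z)

      lowerSlope : VanishingWithSlope (sum (λ k → coeff k * bernoulli (toℕ k))) lowerSum
      lowerSlope = slope-sum (λ k → slope-scale (coeff k) (slope (lower k)))

      numerator : Fun
      numerator z = (z + 1#) ^ suc a - 1# + - 1# * lowerSum z

      -- Division by `ι (suc a)` in `nextBernoulli` unfolds to multiplication by `r`, so after
      -- reading the lower Bernoulli numbers from the table the two sides differ only by ring laws.
      slope≡bernoulli : r * (ι (suc a) + - 1# * sum (λ k → coeff k * bernoulli (toℕ k))) ≡ bernoulli a
      slope≡bernoulli = begin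
        r * (ι (suc a) + - 1# * sum (λ k → coeff k * bernoulli (toℕ k)))
          ≡⟨ cong (λ s → r * (ι (suc a) + - 1# * s))
               (sum-cong-≗ λ k → cong (coeff k *_) (sym (lookup-bernoullis a k))) ⟩
        r * (ι (suc a) + - 1# * sum (λ k → coeff k * lookup (bernoullis a) k))
          ≡⟨ solve 3 (λ r n s → r :* (n :+ :- con (+ 1) :* s) := (n :- s) :* r) refl
               r (ι (suc a)) (sum (λ k → coeff k * lookup (bernoullis a) k)) ⟩
        bernoulli a
          ∎

      lowerSum-difference : ∀ z → lowerSum z - lowerSum (z - 1#) ≡ sum (λ k → coeff k * z ^ toℕ k)
      lowerSum-difference z = trans
        (sum-‿- (λ k → coeff k * sumUpTo (lower k) z) (λ k → coeff k * sumUpTo (lower k) (z - 1#)))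
        (sum-cong-≗ λ k → trans
          (solve 3 (λ c x y → c :* x :- c :* y := c :* (x :- y)) refl (coeff k) _ _)
          (cong (coeff k *_) (difference (lower k) z)))

      -- `lowerSum` is built so that its difference is the sum of all lower terms in
      -- `power-difference`; only the term with z^a survives.
      numerator-difference : ∀ z → numerator z - numerator (z - 1#) ≡ ι (suc a) * z ^ a
      numerator-difference z = begin
        numerator z - numerator (z - 1#)
          ≡⟨ solve 4 (λ x y s t → x :- con (+ 1) :+ :- con (+ 1) :* s :- (y :- con (+ 1) :+ :- con (+ 1) :* t)
               := x :- y :- (s :- t)) refl
               ((z + 1#) ^ suc a) ((z - 1# + 1#) ^ suc a) (lowerSum z) (lowerSum (z - 1#)) ⟩
        (z + 1#) ^ suc a - (z - 1# + 1#) ^ suc a - (lowerSum z - lowerSum (z - 1#))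
          ≡⟨ cong₂ (λ w d → (z + 1#) ^ suc a - w ^ suc a - d)
               (solve 1 (λ z → z :- con (+ 1) :+ con (+ 1) := z) refl z) (lowerSum-difference z) ⟩
        (z + 1#) ^ suc a - z ^ suc a - sum (λ k → coeff k * z ^ toℕ k)
          ≡⟨ cong (_- sum (λ k → coeff k * z ^ toℕ k)) (power-difference a z) ⟩
        sum (λ k → coeff k * z ^ toℕ k) + ι (suc a) * z ^ a - sum (λ k → coeff k * z ^ toℕ k)
          ≡⟨ solve 2 (λ s t → s :+ t :- s := t) refl (sum (λ k → coeff k * z ^ toℕ k)) (ι (suc a) * z ^ a) ⟩
        ι (suc a) * z ^ a
          ∎

-- From the axioms of a fractional sum to its values on powers.

module Essence (ℝ : CompleteOrderedField) where
  open FractionalSums ℝ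
  open ComplexField ℝ
  open PolynomialFunctions ℝ
  open Faulhaber ℝ
  open IntegerCoefficientSolver ℂ-commutativeRing
  open RingProperties ring using (x≈y⇒x∙y⁻¹≈ε; x∙y⁻¹≈ε⇒x≈y)
  open ≡-Reasoning

  polynomialSum : ∀ {f Q} → Polynomial Q → (∀ z → Q z - Q (z - 1#) ≡ f z) → Q 0# ≡ 0# →
                  ∀ x y → IsPolynomialSum f x y (Q y - Q (x - 1#))
  polynomialSum Q-poly ΔQ≗f Q0≡0 x y with coefficients Q-poly
  ... | d , q , q≗Q = d , q
    , (λ z → trans (cong₂ _-_ (q≗Q z) (q≗Q (z - 1#))) (ΔQ≗f z))
    , trans (q≗Q 0#) Q0≡0
    , sym (cong₂ _-_ (q≗Q y) (q≗Q (x - 1#)))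

  shift-∈ : ∀ {ℓ} {U : Pred Fun ℓ} {f} → f ∈ 𝐒 U → ∀ s → shift f s ∈ 𝐒 U
  shift-∈ (n , c , g , g∈𝐓U , f≗) s = n , c , (λ i → shift (g i) s) , shifted , λ x → f≗ (x + s)
    where
    shifted : ∀ i → shift (g i) s ∈ 𝐓 _
    shifted i with g∈𝐓U i
    ... | g′ , c′ , g′∈U , g≗ = g′ , s + c′ , g′∈U , λ x →
      trans (g≗ (x + s)) (cong g′ (solve 3 (λ x s c → x :+ s :+ c := x :+ (s :+ c)) refl x s c′))

  module _ {ℓ} {U : Pred Fun ℓ} {S : SumMap U} (A : SumAxioms U S) where
    open SumMap S
    open SumAxioms A

    -- Translation by x - 1 carries the one-term sum at 1 to any complex point x.
    sum-singleton : ∀ {f} (p : f ∈ 𝐒 U) x → ⟦ p ⟧ x x ≡ f x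
    sum-singleton {f} p x = begin
      ⟦ p ⟧ x x                              ≡⟨ cong₂ ⟦ p ⟧ x≡1+s x≡1+s ⟩
      ⟦ p ⟧ (1# + (x - 1#)) (1# + (x - 1#))  ≡⟨ translationInvariance p (x - 1#) (shift-∈ p (x - 1#)) 1# 1# ⟩
      ⟦ shift-∈ p (x - 1#) ⟧ 1# 1#           ≡⟨ classicalConsistency (shift-∈ p (x - 1#)) ⟩
      f (1# + (x - 1#))                      ≡⟨ cong f x≡1+s ⟨
      f x                                    ∎
      where
      x≡1+s : x ≡ 1# + (x - 1#)
      x≡1+s = solve 1 (λ x → x := con (+ 1) :+ (x :- con (+ 1))) refl x

    -- The sum from x to y + 1 is split in two ways: before its last term and after its first.
    sum-succ : ∀ {f} (p : f ∈ 𝐒 U) x y →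
      ⟦ p ⟧ x y + f (y + 1#) ≡ f x + ⟦ p ⟧ (x + 1#) (y + 1#)
    sum-succ {f} p x y = begin
      ⟦ p ⟧ x y + f (y + 1#)                    ≡⟨ cong (λ w → ⟦ p ⟧ x y + w) (sum-singleton p (y + 1#)) ⟨
      ⟦ p ⟧ x y + ⟦ p ⟧ (y + 1#) (y + 1#)       ≡⟨ continuedSummation p x y (y + 1#) ⟩
      ⟦ p ⟧ x (y + 1#)                          ≡⟨ continuedSummation p x x (y + 1#) ⟨
      ⟦ p ⟧ x x + ⟦ p ⟧ (x + 1#) (y + 1#)       ≡⟨ cong (λ w → w + ⟦ p ⟧ (x + 1#) (y + 1#)) (sum-singleton p x) ⟩
      f x + ⟦ p ⟧ (x + 1#) (y + 1#)             ∎

    module _ {a : ℕ} (Pₐ : PowerSum a) (p : (λ x → x ^ a) ∈ 𝐒 U) where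
      open PowerSum Pₐ renaming (sumUpTo to P)

      defect : ℂ → ℂ → ℂ
      defect x y = ⟦ p ⟧ x y - (P y - P (x - 1#))

      -- Both the sum and its polynomial candidate change by (y + 1)^a - x^a: one by `sum-succ`, the
      -- other by `difference`.
      defect-succ : ∀ x y → defect (x + 1#) (y + 1#) ≡ defect x y
      defect-succ x y = begin
        ⟦ p ⟧ (x + 1#) (y + 1#) - (P (y + 1#) - P (x + 1# - 1#))
          -- x^a is added and subtracted to produce the right side of `sum-succ`.
          ≡⟨ solve 4 (λ t f u v → t :- (u :- v) := f :+ t :- f :- u :+ v) refl
               (⟦ p ⟧ (x + 1#) (y + 1#)) (x ^ a) (P (y + 1#)) (P (x + 1# - 1#)) ⟩
        x ^ a + ⟦ p ⟧ (x + 1#) (y + 1#) - x ^ a - P (y + 1#) + P (x + 1# - 1#)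
          ≡⟨ cong₂ (λ s w → s - x ^ a - P (y + 1#) + P w) (sym (sum-succ p x y)) (cancel x) ⟩
        ⟦ p ⟧ x y + (y + 1#) ^ a - x ^ a - P (y + 1#) + P x
          ≡⟨ cong₂ (λ f g → ⟦ p ⟧ x y + g - f - P (y + 1#) + P x)
               (sym (difference x)) (trans (sym (difference (y + 1#))) (cong (λ w → P (y + 1#) - P w) (cancel y))) ⟩
        ⟦ p ⟧ x y + (P (y + 1#) - P y) - (P x - P (x - 1#)) - P (y + 1#) + P x
          ≡⟨ solve 5 (λ s u v w t → s :+ (u :- v) :- (w :- t) :- u :+ w := s :- (v :- t)) refl
               (⟦ p ⟧ x y) (P (y + 1#)) (P y) (P x) (P (x - 1#)) ⟩
        defect x y
          ∎
        where
        cancel : ∀ x → x + 1# - 1# ≡ x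
        cancel = solve 1 (λ x → x :+ con (+ 1) :- con (+ 1) := x) refl

      -- By translation invariance the left side is the n-th error term of
      -- `polynomialShiftContinuity`, which is therefore a constant sequence.
      defect-shift : ∀ n x y → defect (x + ι n) (y + ι n) ≡ defect x y
      defect-shift zero x y = cong₂ defect (+-identityʳ x) (+-identityʳ y)
      defect-shift (suc n) x y = trans
        (cong₂ defect (rearrange x) (rearrange y))
        (trans (defect-succ (x + ι n) (y + ι n)) (defect-shift n x y))
        where
        rearrange : ∀ x → x + (1# + ι n) ≡ x + ι n + 1#
        rearrange x = solve 2 (λ x m → x :+ (con (+ 1) :+ m) := x :+ m :+ con (+ 1)) refl x (ι n)

      -- The witness is z ↦ P(z + n) - P(n): the constant restores the value 0 at the origin and
      -- cancels in differences.
      shiftedSum : ∀ n x y → IsPolynomialSum (shift (eval (monomial a)) (ι n)) x y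
        (P (y + ι n) - P (x + ι n - 1#))
      shiftedSum n x y = subst (IsPolynomialSum _ x y) (Q-difference y (x - 1#) (swap x))
        (polynomialSum
          (Polynomial-+ (Polynomial-shift (ι n) (slope⇒Polynomial slope)) (const (- P (ι n)) λ _ → refl))
          (λ z → trans (Q-difference z (z - 1#) (swap z))
            (trans (difference (z + ι n)) (sym (eval-monomial a (z + ι n)))))
          (trans (cong (λ w → P w - P (ι n)) (+-identityˡ (ι n))) (x≈y⇒x∙y⁻¹≈ε refl))
          x y)
        where
        swap : ∀ z → z - 1# + ι n ≡ z + ι n - 1#
        swap z = solve 2 (λ z m → z :- con (+ 1) :+ m := z :+ m :- con (+ 1)) refl z (ι n)

        Q-difference : ∀ z w {v} → w + ι n ≡ v →
          P (z + ι n) - P (ι n) - (P (w + ι n) - P (ι n)) ≡ P (z + ι n) - P v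
        Q-difference z w refl =
          solve 3 (λ u v c → u :- c :- (v :- c) := u :- v) refl (P (z + ι n)) (P (w + ι n)) (P (ι n))

      -- polynomialShiftContinuity applies to the approximation of xᵃ by itself.
      sum-power : ∀ x y → ⟦ p ⟧ x y ≡ P y - P (x - 1#)
      sum-power x y = x∙y⁻¹≈ε⇒x≈y _ _ (constant-limit
        (λ n → trans
          (cong (_- (P (y + ι n) - P (x + ι n - 1#)))
            (sym (translationInvariance p (ι n) (shift-∈ p (ι n)) x y)))
          (defect-shift n x y))
        (polynomialShiftContinuity p (λ _ → monomial a) (inj₁ λ _ → leading≢0)
          (λ t → limit-of-constant λ n → x≈y⇒x∙y⁻¹≈ε (sym (eval-monomial a (t + ι n))))
          (λ n → shift-∈ p (ι n)) x y _ (λ n → shiftedSum n x y)))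
        where
        leading≢0 : monomial a (fromℕ a) ≢ 0#
        leading≢0 = 1≢0 ∘ trans (sym (monomial-leading a))

      -- With lower limit 1 the boundary term is P(0) = 0, so the sum up to h is P(h) and has the
      -- expansion of P at the origin.
      essence-power : (λ h → 1# / h * ⟦ p ⟧ 1# h) ⟶₀ bernoulli a
      essence-power = slope⇒⟶₀ (slope-cong sum-from-1 slope)
        where
        P[1-1]≡0 : P (1# - 1#) ≡ 0#
        P[1-1]≡0 = trans (VanishingWithSlope.factors slope (1# - 1#))
          (solve 1 (λ w → (con (+ 1) :- con (+ 1)) :* w := con (+ 0)) refl _)

        sum-from-1 : ∀ h → P h ≡ ⟦ p ⟧ 1# h
        sum-from-1 h = sym (begin
          ⟦ p ⟧ 1# h          ≡⟨ sum-power 1# h ⟩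
          P h - P (1# - 1#)   ≡⟨ cong (λ w → P h - w) P[1-1]≡0 ⟩
          P h - 0#            ≡⟨ solve 1 (λ x → x :- con (+ 0) := x) refl (P h) ⟩
          P h                 ∎)

theorem4p2p8 : (ℝ : CompleteOrderedField) →
    let open FractionalSums ℝ in
    ∀ {ℓ} (a : ℕ) (U : Pred Fun ℓ) (𝓤 : SummableSet U) →
    (xᵃ∈𝐒U : (λ x → x ^ a) ∈ 𝐒 U) →
    HasEssence 𝓤 xᵃ∈𝐒U (bernoulli a)
theorem4p2p8 ℝ a U 𝓤 xᵃ∈𝐒U =
  Essence.essence-power ℝ (FractionalSums.SummableSet.axioms 𝓤) (Faulhaber.powerSum ℝ a) xᵃ∈𝐒U
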